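{- The common terms of the Fibonacci and Lucas numbers with positive indices are exactly $1$ and $3$; that is, $$\{F_k : k \geqslant 1\} \cap \{L_n : n \geqslant 1\} = \{1, 3\}.$$
   Context: $(F_n)_{n\geqslant 0}$ is the Fibonacci sequence: $F_0=0$, $F_1=1$, $F_{n+1}=F_n+F_{n-1}$ for $n \geqslant 1$. $(L_n)_{n\geqslant 0}$ is the Lucas sequence: $L_0=2$, $L_1=1$, $L_{n+1}=L_n+L_{n-1}$ for $n\geqslant 1$. Only terms with positive indices are considered. -}

module Defs where

open import Data.Nat using (ℕ; zero; suc; _+_; _≥_)
open import Data.Product using (∃-syntax; _×_)
open import Level using (0ℓ)
open import Relation.Binary.PropositionalEquality using (_≡_)
open import Relation.Unary using (Pred)

F : ℕ → ℕ
F zero          = 0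
F (suc zero)    = 1
F (suc (suc n)) = F (suc n) + F n

L : ℕ → ℕ
L zero          = 2
L (suc zero)    = 1
L (suc (suc n)) = L (suc n) + L n

-- The set { u k : k ≥ 1 }; the term at index 0 is left out.
PositiveIndexTerms : (ℕ → ℕ) → Pred ℕ 0ℓ
PositiveIndexTerms u m = ∃[ k ] (k ≥ 1 × u k ≡ m)

{-# OPTIONS --safe #-}
-- For n ≥ 3 the Lucas number L n lies strictly between the consecutive
-- Fibonacci numbers F (n + 1) and F (n + 2), so it is not a Fibonacci number;
-- L 1 = 1 and L 2 = 3 remain.
module Submission where

open import Defs
open import Relation.Unary using (_∩_; _∪_; _≐_; ｛_｝)
open import Data.Nat using (zero; suc; _+_; _≤_; _<_; _≤′_; ≤′-refl; ≤′-step; z≤n; s≤s)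
open import Data.Nat.Properties
  using (≤-refl; ≤-trans; m≤m+n; +-mono-<; ≤⇒≤′; <-≤-trans; ≤-<-trans; <⇒≢; >⇒≢; _<?_; ≮⇒≥)
open import Data.Product using (_,_)
open import Data.Sum using (inj₁; inj₂)
open import Relation.Binary.PropositionalEquality using (_≢_; refl)
open import Relation.Nullary using (yes; no; contradiction)
open import Relation.Nullary.Decidable using (from-yes)

-- Both sequences obey the same second-order recurrence, so a strict inequality between shifts of
-- them, once true at two consecutive indices, propagates by addition. As `F` is monotone, no term
-- of it fits in the resulting gap around `L (3 + n)`.

F[n]≤F[1+n] : ∀ n → F n ≤ F (suc n)
F[n]≤F[1+n] zero    = z≤n
F[n]≤F[1+n] (suc n) = m≤m+n (F (suc n)) (F n)

F-mono-≤ : ∀ {m n} → m ≤ n → F m ≤ F n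
F-mono-≤ m≤n = go (≤⇒≤′ m≤n)
  where
  go : ∀ {m n} → m ≤′ n → F m ≤ F n
  go ≤′-refl           = ≤-refl
  go (≤′-step {n} m≤n) = ≤-trans (go m≤n) (F[n]≤F[1+n] n)

F[4+n]<L[3+n] : ∀ n → F (4 + n) < L (3 + n)
F[4+n]<L[3+n] zero          = from-yes (3 <? 4)
F[4+n]<L[3+n] (suc zero)    = from-yes (5 <? 7)
F[4+n]<L[3+n] (suc (suc n)) = +-mono-< (F[4+n]<L[3+n] (suc n)) (F[4+n]<L[3+n] n)

-- Strictness fails one index earlier, where `L 2` and `F 4` are both 3; hence the offset.
L[3+n]<F[5+n] : ∀ n → L (3 + n) < F (5 + n)
L[3+n]<F[5+n] zero          = from-yes (4 <? 5)
L[3+n]<F[5+n] (suc zero)    = from-yes (7 <? 8)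
L[3+n]<F[5+n] (suc (suc n)) = +-mono-< (L[3+n]<F[5+n] (suc n)) (L[3+n]<F[5+n] n)

F[k]≢L[3+n] : ∀ k n → F k ≢ L (3 + n)
F[k]≢L[3+n] k n with 4 + n <? k
-- `4 + n < k` unfolds to `5 + n ≤ k`, so `k` lies on one side or the other of the gap.
... | yes 4+n<k = >⇒≢ (<-≤-trans (L[3+n]<F[5+n] n) (F-mono-≤ 4+n<k))
... | no  4+n≮k = <⇒≢ (≤-<-trans (F-mono-≤ (≮⇒≥ 4+n≮k)) (F[4+n]<L[3+n] n))

corollary1 : PositiveIndexTerms F ∩ PositiveIndexTerms L ≐ ｛ 1 ｝ ∪ ｛ 3 ｝
corollary1 =
  -- Index 0 of `L` is impossible because `0 ≥ 1` is empty; `L 0` is 2, which equals `F 3`.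
  (λ { (_ , (1 , _ , L₁≡m))                               → inj₁ L₁≡m
     ; (_ , (2 , _ , L₂≡m))                               → inj₂ L₂≡m
     ; ((k , _ , Fₖ≡m) , (suc (suc (suc n)) , _ , refl)) → contradiction Fₖ≡m (F[k]≢L[3+n] k n)
     }) ,
  (λ { (inj₁ refl) → (1 , s≤s z≤n , refl) , (1 , s≤s z≤n , refl)
     ; (inj₂ refl) → (4 , s≤s z≤n , refl) , (2 , s≤s z≤n , refl)
     })
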